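{- Let $d\in\mathbb{N}$ and let $\mathcal{M},\mathcal{G}\subseteq\mathbb{N}_0^d$ be non-empty games. Then $\mathcal{M}^\infty=\mathcal{G}^\infty$ if and only if $\min(\mathcal{M})=\min(\mathcal{G})$.
   Context: For $d\in\mathbb{N}$ a game is a set $\mathcal{M}\subseteq\mathbb{N}_0^d$ of moves. From position $\boldsymbol x$ a player may move to $\boldsymbol y\in\mathbb{N}_0^d$ iff $\boldsymbol x-\boldsymbol y\in\mathcal{M}$. Misère play: a player who cannot move wins. If $\boldsymbol 0\in\mathcal{M}$, $P(\mathcal{M})=\varnothing$. Otherwise: a position is an N-position if it has no option or some option is a P-position; otherwise it is a P-position; $P(\mathcal{M})$ denotes the set of P-positions. The $\star$-operator is $\mathcal{M}^\star=P(\mathcal{M})$; $\mathcal{M}^0=\mathcal{M}$, $\mathcal{M}^i=(\mathcal{M}^{i-1})^\star$. $\mathcal{M}^\infty=\lim_i\mathcal{M}^i$ is the pointwise limit (the set of $\boldsymbol x$ lying in $\mathcal{M}^i$ for all sufficiently large $i$, where every $\boldsymbol x$ is eventually always in or eventually always out); it always exists. $\min(S)$ is the set of minimal elements of $S$ under the componentwise partial order. -}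

module Defs where

open import Data.Nat.Base using (ℕ; zero; suc; _+_; _≤_; _<_; z<s)
open import Data.Nat.Induction using (<-wellFounded)
open import Data.Nat.Properties
  using (m≤m+n; m<m+n; +-mono-≤; +-mono-≤-<; +-mono-<-≤; ≤-refl)
open import Data.Product.Base using (∃-syntax; Σ-syntax; _×_; _,_)
open import Data.Sum.Base using (_⊎_)
open import Data.Vec.Base using (Vec; []; _∷_; replicate; sum; zipWith)
open import Data.Vec.Relation.Binary.Pointwise.Inductive using (Pointwise)
open import Function.Base using (_∘_; _on_)
open import Induction.WellFounded using (Acc; acc; WellFounded; module Subrelation)
open import Level using (0ℓ)
open import Relation.Binary.Core using (Rel)
import Relation.Binary.Construct.On as On
open import Relation.Binary.PropositionalEquality.Core using (_≡_; refl; cong)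
open import Relation.Nullary.Negation.Core using (¬_; contradiction)
open import Relation.Unary using (Pred; _∈_; _∉_)

Position : ℕ → Set
Position d = Vec ℕ d

-- Arbitrary subsets, with no decidability assumed: classical reasoning about
-- them has to come from an explicit excluded-middle hypothesis.
Game : ℕ → Set₁
Game d = Pred (Position d) 0ℓ

𝟎 : ∀ {d} → Position d
𝟎 = replicate _ 0

infixl 6 _⊕_
_⊕_ : ∀ {d} → Position d → Position d → Position d
_⊕_ = zipWith _+_

infix 4 _≼_
_≼_ : ∀ {d} → Rel (Position d) 0ℓ
_≼_ = Pointwise _≤_

-- y is an option of x when x − y ∈ M; since M ⊆ ℕᵈ, this says that
-- x = y + m for some m ∈ M, which avoids subtraction.
OptionOf : ∀ {d} → Game d → Rel (Position d) 0ℓ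
OptionOf M y x = ∃[ m ] m ∈ M × y ⊕ m ≡ x

sum-⊕-≤ : ∀ {d} (y m : Position d) → sum y ≤ sum (y ⊕ m)
sum-⊕-≤ []      []      = ≤-refl
sum-⊕-≤ (a ∷ y) (b ∷ m) = +-mono-≤ (m≤m+n a b) (sum-⊕-≤ y m)

sum-⊕-< : ∀ {d} (y m : Position d) → ¬ m ≡ 𝟎 → sum y < sum (y ⊕ m)
sum-⊕-< []      []          m≢𝟎 = contradiction refl m≢𝟎
sum-⊕-< (a ∷ y) (zero  ∷ m) m≢𝟎 =
  +-mono-≤-< (m≤m+n a 0) (sum-⊕-< y m (m≢𝟎 ∘ cong (0 ∷_)))
sum-⊕-< (a ∷ y) (suc b ∷ m) m≢𝟎 =
  +-mono-<-≤ (m<m+n a z<s) (sum-⊕-≤ y m)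

optionOf-wellFounded : ∀ {d} {M : Game d} → 𝟎 ∉ M → WellFounded (OptionOf M)
optionOf-wellFounded {M = M} 𝟎∉M =
  Subrelation.wellFounded decreases (On.wellFounded sum <-wellFounded)
  where
  decreases : ∀ {y x} → OptionOf M y x → (_<_ on sum) y x
  decreases {y} (m , m∈M , refl) = sum-⊕-< y m λ { refl → 𝟎∉M m∈M }

-- The recursion runs along the option relation. A P-position is one that
-- is not an N-position, hence the negation in the second summand.
IsN : ∀ {d} (M : Game d) (x : Position d) → Acc (OptionOf M) x → Set
IsN M x (acc rs) =
    (¬ (∃[ y ] OptionOf M y x))
  ⊎ (∃[ y ] Σ[ o ∈ OptionOf M y x ] ¬ IsN M y (rs o))

-- Empty when 𝟎 ∈ M.
P : ∀ {d} → Game d → Game d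
P M x = Σ[ 𝟎∉M ∈ 𝟎 ∉ M ] ¬ IsN M x (optionOf-wellFounded 𝟎∉M x)

infixl 8 _⋆
_⋆ : ∀ {d} → Game d → Game d
M ⋆ = P M

infixl 8 _^⋆_
_^⋆_ : ∀ {d} → Game d → ℕ → Game d
M ^⋆ zero  = M
M ^⋆ suc i = (M ^⋆ i) ⋆

infixl 8 _^∞
_^∞ : ∀ {d} → Game d → Game d
(M ^∞) x = ∃[ k ] (∀ i → k ≤ i → x ∈ M ^⋆ i)

min : ∀ {d} → Game d → Game d
min S x = x ∈ S × (∀ y → y ∈ S → y ≼ x → y ≡ x)

{-# OPTIONS --safe #-}
-- Suppose 𝟎 ∉ M.  A minimal move x has 𝟎 as its only option, so it is a
-- P-position; and a P-position has an option, so it dominates a move.  Hence M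
-- and M ⋆ have the same minimal elements, and so do all M ^⋆ i and M ^∞.
-- Conversely, x belongs to M ^⋆ (i + 1) iff x dominates a minimal move and there
-- is no m ≢ x in M ^⋆ i with x − m in M ^⋆ (i + 1).  Both m and x − m have smaller
-- coordinate sum than x, so by induction M ^⋆ i agrees with G ^⋆ i on all x with
-- sum x ≤ i as soon as min M = min G.  If 𝟎 ∈ M, then min M = {𝟎} and M ^∞ = ∅.
module Submission where

open import Defs
open import Axiom.DoubleNegationElimination using (em⇒dne)
open import Axiom.ExcludedMiddle using (ExcludedMiddle)
open import Data.Nat.Base using (ℕ; zero; suc; NonZero; _+_; _≤_; _<_; z≤n)
open import Data.Nat.Induction using (<-wellFounded)
open import Data.Nat.Properties as ℕ
  using (≤-pred; <-≤-trans; <⇒≤; m∸n+n≡m; m≤n+m; n≤0⇒n≡0; m+n≡0⇒m≡0; m+n≡0⇒n≡0)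
open import Data.Product.Base using (∃-syntax; _×_; _,_; proj₁; proj₂; swap)
open import Data.Sum.Base using (inj₁; inj₂)
open import Data.Vec.Base using ([]; _∷_; head; tail; sum)
open import Data.Vec.Properties using (zipWith-comm; zipWith-identityˡ)
open import Data.Vec.Relation.Binary.Pointwise.Inductive as Pointwise
  using ([]; _∷_)
open import Function.Base using (_∘_)
open import Function.Bundles using (_⇔_; mk⇔)
open import Induction.WellFounded using (Acc; acc)
open import Level using (0ℓ)
open import Relation.Binary.PropositionalEquality
  using (_≡_; refl; sym; trans; cong; cong₂; subst)
open import Relation.Nullary using (¬_; yes; no; contradiction)
open import Relation.Unary using (Satisfiable; Empty; _∈_; _∉_; _⊆_; _≐_)

private
  variable
    d : ℕ
    M G : Game d
    x y m : Position d

-- The componentwise order and coordinate sums.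

≼-refl : x ≼ x
≼-refl = Pointwise.refl ℕ.≤-refl

≼-trans : x ≼ y → y ≼ m → x ≼ m
≼-trans = Pointwise.trans ℕ.≤-trans

≼-antisym : x ≼ y → y ≼ x → x ≡ y
≼-antisym []        []        = refl
≼-antisym (p ∷ x≼y) (q ∷ y≼x) = cong₂ _∷_ (ℕ.≤-antisym p q) (≼-antisym x≼y y≼x)

𝟎≼ : (x : Position d) → 𝟎 ≼ x
𝟎≼ []      = []
𝟎≼ (_ ∷ x) = z≤n ∷ 𝟎≼ x

≼𝟎⇒≡𝟎 : x ≼ 𝟎 → x ≡ 𝟎
≼𝟎⇒≡𝟎 {x = x} x≼𝟎 = ≼-antisym x≼𝟎 (𝟎≼ x)

⊕-identityˡ : (x : Position d) → 𝟎 ⊕ x ≡ x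
⊕-identityˡ = zipWith-identityˡ ℕ.+-identityˡ

⊕-comm : (x y : Position d) → x ⊕ y ≡ y ⊕ x
⊕-comm = zipWith-comm ℕ.+-comm

m≼y⊕m : (y m : Position d) → m ≼ y ⊕ m
m≼y⊕m []      []      = []
m≼y⊕m (a ∷ y) (b ∷ m) = m≤n+m b a ∷ m≼y⊕m y m

≼⇒∃⊕ : m ≼ x → ∃[ y ] y ⊕ m ≡ x
≼⇒∃⊕ []          = [] , refl
≼⇒∃⊕ (p ∷ m≼x) with y , eq ← ≼⇒∃⊕ m≼x = _ ∷ y , cong₂ _∷_ (m∸n+n≡m p) eq

sum≡0⇒≡𝟎 : (x : Position d) → sum x ≡ 0 → x ≡ 𝟎
sum≡0⇒≡𝟎 []      _  = refl
sum≡0⇒≡𝟎 (a ∷ x) eq =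
  cong₂ _∷_ (m+n≡0⇒m≡0 a eq) (sum≡0⇒≡𝟎 x (m+n≡0⇒n≡0 a eq))

sum-⊕-<ʳ : (y m : Position d) → ¬ y ≡ 𝟎 → sum m < sum (y ⊕ m)
sum-⊕-<ʳ y m y≢𝟎 = subst (λ z → sum m < sum z) (⊕-comm m y) (sum-⊕-< m y y≢𝟎)

y⊕m≡m⇒y≡𝟎 : (y m : Position d) → y ⊕ m ≡ m → y ≡ 𝟎
y⊕m≡m⇒y≡𝟎 []      []      _  = refl
y⊕m≡m⇒y≡𝟎 (a ∷ y) (b ∷ m) eq = cong₂ _∷_
  (ℕ.+-cancelʳ-≡ b a 0 (cong head eq))
  (y⊕m≡m⇒y≡𝟎 y m (cong tail eq))

≼∧≢⇒sum< : y ≼ x → ¬ y ≡ x → sum y < sum x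
≼∧≢⇒sum< {y = y} y≼x y≢x with z , refl ← ≼⇒∃⊕ y≼x =
  sum-⊕-<ʳ z y λ { refl → y≢x (sym (⊕-identityˡ y)) }

-- Upward closures and minimal elements.

↑ : Game d → Game d
↑ M x = ∃[ m ] m ∈ M × m ≼ x

hasOption⇒∈↑ : ∃[ y ] OptionOf M y x → x ∈ ↑ M
hasOption⇒∈↑ (y , m , m∈M , refl) = m , m∈M , m≼y⊕m y m

∈↑⇒hasOption : x ∈ ↑ M → ∃[ y ] OptionOf M y x
∈↑⇒hasOption (m , m∈M , m≼x) with y , eq ← ≼⇒∃⊕ m≼x = y , m , m∈M , eq

𝟎∈⇒min : 𝟎 ∈ M → 𝟎 ∈ min M
𝟎∈⇒min 𝟎∈M = 𝟎∈M , λ _ _ → ≼𝟎⇒≡𝟎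

𝟎∈⇒min≡𝟎 : 𝟎 ∈ M → x ∈ min M → x ≡ 𝟎
𝟎∈⇒min≡𝟎 {x = x} 𝟎∈M (_ , minimal) = sym (minimal 𝟎 𝟎∈M (𝟎≼ x))

min-resp-⊆ : {A B : Game d} → A ≐ B → min A ⊆ min B
min-resp-⊆ (A⊆B , B⊆A) (x∈A , minimal) = A⊆B x∈A , λ y → minimal y ∘ B⊆A

min-cong : {A B : Game d} → A ≐ B → min A ≐ min B
min-cong A≐B = min-resp-⊆ A≐B , min-resp-⊆ (swap A≐B)

-- P-positions described by their options.

IsN-irrelevant : (p q : Acc (OptionOf M) x) → IsN M x p → IsN M x q
IsN-irrelevant (acc _) (acc _) (inj₁ stuck)         = inj₁ stuck
-- `IsN` occurs negated in its own recursion, so the two accessibility proofs trade places in the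
-- recursive call.
IsN-irrelevant (acc r) (acc s) (inj₂ (y , o , ¬N)) =
  inj₂ (y , o , ¬N ∘ IsN-irrelevant (s o) (r o))

noOption⇒IsN : (p : Acc (OptionOf M) x) → ¬ (∃[ y ] OptionOf M y x) → IsN M x p
noOption⇒IsN (acc _) = inj₁

option⇒IsN : (p : Acc (OptionOf M) x) (q : Acc (OptionOf M) y) →
             OptionOf M y x → ¬ IsN M y q → IsN M x p
option⇒IsN (acc rs) q o ¬N = inj₂ (_ , o , ¬N ∘ IsN-irrelevant (rs o) q)

∈⋆⇒options∉⋆ : x ∈ M ⋆ → OptionOf M y x → y ∉ M ⋆
∈⋆⇒options∉⋆ (_ , ¬Nx) o (_ , ¬Ny) = ¬Nx (option⇒IsN _ _ o ¬Ny)

-- With `∈⋆⇒options∉⋆`, this replaces recursion over accessibility proofs by plain membership in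
-- `M ⋆`.
options∉⋆⇒∈⋆ : 𝟎 ∉ M → x ∈ ↑ M → (∀ y → OptionOf M y x → y ∉ M ⋆) → x ∈ M ⋆
options∉⋆⇒∈⋆ {M = M} {x = x} 𝟎∉M x∈↑M options∉ = 𝟎∉M , ¬N (wf x)
  where
  wf = optionOf-wellFounded {M = M} 𝟎∉M
  ¬N : (a : Acc (OptionOf M) x) → ¬ IsN M x a
  ¬N (acc rs) (inj₁ stuck)         = stuck (∈↑⇒hasOption x∈↑M)
  ¬N (acc rs) (inj₂ (y , o , ¬Ny)) =
    options∉ y o (𝟎∉M , ¬Ny ∘ IsN-irrelevant (wf y) (rs o))

-- Iterates and limits.

module _ (em : ExcludedMiddle 0ℓ) where

  -- A stuck player wins, so a position without options is an N-position. Excluded middle turns the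
  -- double negation into an actual move.
  ⋆⊆↑ : M ⋆ ⊆ ↑ M
  ⋆⊆↑ (_ , ¬N) = hasOption⇒∈↑ (em⇒dne em (¬N ∘ noOption⇒IsN _))

  𝟎∉⋆ : 𝟎 ∉ M ⋆
  𝟎∉⋆ {M = M} p@(𝟎∉M , _) with m , m∈M , m≼𝟎 ← ⋆⊆↑ {M = M} p =
    𝟎∉M (subst M (≼𝟎⇒≡𝟎 m≼𝟎) m∈M)

  𝟎∉^⋆ : 𝟎 ∉ M → ∀ i → 𝟎 ∉ M ^⋆ i
  𝟎∉^⋆         𝟎∉M zero    = 𝟎∉M
  𝟎∉^⋆ {M = M} 𝟎∉M (suc i) = 𝟎∉⋆ {M = M ^⋆ i}

  𝟎∈⇒^⋆-empty : 𝟎 ∈ M → ∀ i → Empty (M ^⋆ suc i)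
  𝟎∈⇒^⋆-empty         𝟎∈M zero    x (𝟎∉M , _) = 𝟎∉M 𝟎∈M
  -- Such an `x` would need a move in the previous iterate, which is already empty.
  𝟎∈⇒^⋆-empty {M = M} 𝟎∈M (suc i) x x∈
    with m , m∈ , _ ← ⋆⊆↑ {M = M ^⋆ suc i} x∈ = 𝟎∈⇒^⋆-empty {M = M} 𝟎∈M i m m∈

  𝟎∈⇒^∞-empty : 𝟎 ∈ M → Empty (M ^∞)
  𝟎∈⇒^∞-empty {M = M} 𝟎∈M x (k , x∈) =
    𝟎∈⇒^⋆-empty {M = M} 𝟎∈M k x (x∈ (suc k) (ℕ.n≤1+n k))

  -- Passing to a smaller, distinct element lowers the coordinate sum, so the descent ends at a
  -- minimal one.
  ↑⊆↑min : ↑ M ⊆ ↑ (min M)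
  ↑⊆↑min {M = M} (m , m∈M , m≼x) = descend m (<-wellFounded _) m∈M m≼x
    where
    descend : ∀ m → Acc _<_ (sum m) → m ∈ M → m ≼ x → x ∈ ↑ (min M)
    descend m (acc rs) m∈M m≼x with em {P = ∃[ y ] y ∈ M × y ≼ m × ¬ y ≡ m}
    ... | yes (y , y∈M , y≼m , y≢m) =
      descend y (rs (≼∧≢⇒sum< y≼m y≢m)) y∈M (≼-trans y≼m m≼x)
    ... | no ∄y =
      m , (m∈M , λ y y∈M y≼m → em⇒dne em λ y≢m → ∄y (y , y∈M , y≼m , y≢m)) , m≼x

  min⊆⋆ : 𝟎 ∉ M → min M ⊆ M ⋆
  min⊆⋆ {M = M} 𝟎∉M {x} (x∈M , minimal) =
    options∉⋆⇒∈⋆ 𝟎∉M (x , x∈M , ≼-refl) λ where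
      y (m , m∈M , y⊕m≡x) y∈⋆ →
        -- Minimality forces the move `m` to be `x`, so the option `y` can only be `𝟎`, which is
        -- never a P-position.
        let m≡x = minimal m m∈M (subst (m ≼_) y⊕m≡x (m≼y⊕m y m))
            y≡𝟎 = y⊕m≡m⇒y≡𝟎 y m (trans y⊕m≡x (sym m≡x))
        in 𝟎∉⋆ {M = M} (subst (M ⋆) y≡𝟎 y∈⋆)

  -- Each element of `A` lies above a minimal element of `M`, which is itself in `A`. Both the
  -- iterates and the limit serve as `A`.
  min-fromBetween : {A : Game d} → min M ⊆ A → A ⊆ ↑ M → min M ≐ min A
  min-fromBetween {M = M} {A = A} min⊆A A⊆↑M = to , from
    where
    to : min M ⊆ min A
    to x∈min@(_ , minimal) = min⊆A x∈min , λ y y∈A y≼x →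
      let m , m∈M , m≼y = A⊆↑M y∈A
          m≡x = minimal m m∈M (≼-trans m≼y y≼x)
      in ≼-antisym y≼x (subst (_≼ y) m≡x m≼y)
    from : min A ⊆ min M
    from (x∈A , minimal) =
      let m , m∈min , m≼x = ↑⊆↑min {M = M} (A⊆↑M x∈A)
      in subst (min M) (minimal m (min⊆A m∈min) m≼x) m∈min

  ^⋆⊆↑ : ∀ i → M ^⋆ i ⊆ ↑ M
  ^⋆⊆↑         zero    x∈M = _ , x∈M , ≼-refl
  ^⋆⊆↑ {M = M} (suc i) x∈  =
    let m , m∈ , m≼x = ⋆⊆↑ {M = M ^⋆ i} x∈
        n , n∈ , n≼m = ^⋆⊆↑ {M = M} i m∈
    in n , n∈ , ≼-trans n≼m m≼x

  min⊆^⋆ : 𝟎 ∉ M → ∀ i → min M ⊆ M ^⋆ i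
  min⊆^⋆         𝟎∉M zero    x∈min = proj₁ x∈min
  -- The iterate lies between `min M` and `↑ M`, so `x` is minimal in it and survives one more `⋆`.
  min⊆^⋆ {M = M} 𝟎∉M (suc i) x∈min = min⊆⋆ (𝟎∉^⋆ {M = M} 𝟎∉M i)
    (proj₁ (min-fromBetween (min⊆^⋆ {M = M} 𝟎∉M i) (^⋆⊆↑ i)) x∈min)

  min⊆^∞ : 𝟎 ∉ M → min M ⊆ M ^∞
  min⊆^∞ {M = M} 𝟎∉M x∈min = 0 , λ i _ → min⊆^⋆ {M = M} 𝟎∉M i x∈min

  min-^∞ : 𝟎 ∉ M → min M ≐ min (M ^∞)
  min-^∞ {M = M} 𝟎∉M =
    min-fromBetween (min⊆^∞ {M = M} 𝟎∉M) λ (k , x∈) → ^⋆⊆↑ k (x∈ k ℕ.≤-refl)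

  ^∞-nonempty : 𝟎 ∉ M → Satisfiable M → Satisfiable (M ^∞)
  ^∞-nonempty {M = M} 𝟎∉M (x , x∈M) =
    let m , m∈min , _ = ↑⊆↑min {M = M} (x , x∈M , ≼-refl)
    in m , min⊆^∞ {M = M} 𝟎∉M m∈min

  -- Lying in a `⋆` is a negative condition on moves and options of smaller sum, so the induction on
  -- `sum x` alternates between `M` and `G`.
  ^⋆-agree : 𝟎 ∉ M → 𝟎 ∉ G → min M ≐ min G →
             ∀ x → Acc _<_ (sum x) → ∀ i → sum x ≤ i → x ∈ M ^⋆ i → x ∈ G ^⋆ i
  ^⋆-agree {M = M} 𝟎∉M _ _ x _ zero sum≤0 x∈M =
    contradiction (subst M (sum≡0⇒≡𝟎 x (n≤0⇒n≡0 sum≤0)) x∈M) 𝟎∉M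
  ^⋆-agree {M = M} {G = G} 𝟎∉M 𝟎∉G eq@(minM⊆minG , _) x (acc rs) (suc i) sum≤ x∈ =
    options∉⋆⇒∈⋆ (𝟎∉^⋆ {M = G} 𝟎∉G i) x∈↑G options∉
    where
    x∈↑G : x ∈ ↑ (G ^⋆ i)
    x∈↑G =
      let m , m∈min , m≼x = ↑⊆↑min {M = M} (^⋆⊆↑ {M = M} (suc i) x∈)
      in m , min⊆^⋆ {M = G} 𝟎∉G i (minM⊆minG m∈min) , m≼x

    agreeBelow : ∀ y → sum y < sum x → ∀ j → sum y ≤ j → y ∈ G ^⋆ j → y ∈ M ^⋆ j
    agreeBelow y y<x = ^⋆-agree {M = G} {G = M} 𝟎∉G 𝟎∉M (swap eq) y (rs y<x)

    options∉ : ∀ y → OptionOf (G ^⋆ i) y x → y ∉ G ^⋆ suc i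
    options∉ y (m , m∈G , refl) y∈G =
      let m<x = sum-⊕-<ʳ y m λ { refl → 𝟎∉⋆ {M = G ^⋆ i} y∈G }
          y<x = sum-⊕-< y m λ { refl → 𝟎∉^⋆ {M = G} 𝟎∉G i m∈G }
          -- The strict drop in the sum pays for the move living one iterate earlier:
          -- `sum m < sum x ≤ suc i` gives `sum m ≤ i`.
          m∈M = agreeBelow m m<x i (≤-pred (<-≤-trans m<x sum≤)) m∈G
          y∈M = agreeBelow y y<x (suc i) (<⇒≤ (<-≤-trans y<x sum≤)) y∈G
      in ∈⋆⇒options∉⋆ {M = M ^⋆ i} x∈ (m , m∈M , refl) y∈M

  min≐⇒^∞⊆ : min M ≐ min G → M ^∞ ⊆ G ^∞
  min≐⇒^∞⊆ {M = M} {G = G} eq {x} x∈@(k , x∈M^) with em {P = 𝟎 ∈ M} | em {P = 𝟎 ∈ G}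
  ... | yes 𝟎∈M | _       = contradiction x∈ (𝟎∈⇒^∞-empty {M = M} 𝟎∈M x)
  ... | no 𝟎∉M  | yes 𝟎∈G = contradiction (proj₁ (proj₂ eq (𝟎∈⇒min 𝟎∈G))) 𝟎∉M
  -- From `k` on, `x` lies in the iterates of `M`; from `sum x` on, these agree with those of `G` at
  -- `x`. The bound is at least both.
  ... | no 𝟎∉M  | no 𝟎∉G  = k + sum x , λ i k+sum≤i →
    ^⋆-agree {M = M} {G = G} 𝟎∉M 𝟎∉G eq x (<-wellFounded _) i
      (ℕ.m+n≤o⇒n≤o k k+sum≤i) (x∈M^ i (ℕ.m+n≤o⇒m≤o k k+sum≤i))

  ^∞≐⇒min≐ : Satisfiable M → Satisfiable G → M ^∞ ≐ G ^∞ → min M ≐ min G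
  ^∞≐⇒min≐ {M = M} {G = G} M≢∅ G≢∅ (M⊆G , G⊆M) with em {P = 𝟎 ∈ M} | em {P = 𝟎 ∈ G}
  -- Both limits are empty here, and `𝟎` is the only minimal element of either game.
  ... | yes 𝟎∈M | yes 𝟎∈G =
      (λ x∈ → subst (min G) (sym (𝟎∈⇒min≡𝟎 𝟎∈M x∈)) (𝟎∈⇒min 𝟎∈G))
    , (λ x∈ → subst (min M) (sym (𝟎∈⇒min≡𝟎 𝟎∈G x∈)) (𝟎∈⇒min 𝟎∈M))
  -- A non-empty game without `𝟎` keeps its minimal elements in the limit, which therefore differs
  -- from an empty one.
  ... | yes 𝟎∈M | no 𝟎∉G with x , x∈ ← ^∞-nonempty {M = G} 𝟎∉G G≢∅ =
    contradiction (G⊆M x∈) (𝟎∈⇒^∞-empty {M = M} 𝟎∈M x)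
  ... | no 𝟎∉M | yes 𝟎∈G with x , x∈ ← ^∞-nonempty {M = M} 𝟎∉M M≢∅ =
    contradiction (M⊆G x∈) (𝟎∈⇒^∞-empty {M = G} 𝟎∈G x)
  ... | no 𝟎∉M | no 𝟎∉G =
    let minM⊆ , minM⊇ = min-^∞ {M = M} 𝟎∉M
        minG⊆ , minG⊇ = min-^∞ {M = G} 𝟎∉G
        ∞⊆ , ∞⊇ = min-cong (M⊆G , G⊆M)
    in (λ x∈ → minG⊇ (∞⊆ (minM⊆ x∈))) , (λ x∈ → minM⊇ (∞⊇ (minG⊆ x∈)))

theorem5 : ExcludedMiddle 0ℓ →
    ∀ (d : ℕ) .{{_ : NonZero d}} (M G : Game d) →
    Satisfiable M → Satisfiable G →
    ((M ^∞) ≐ (G ^∞)) ⇔ (min M ≐ min G)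
theorem5 em d M G M≢∅ G≢∅ = mk⇔
  (^∞≐⇒min≐ em M≢∅ G≢∅)
  (λ eq → min≐⇒^∞⊆ em {M = M} {G = G} eq , min≐⇒^∞⊆ em {M = G} {G = M} (swap eq))
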